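{- Let $n\ge 3$ and let $C_n=(v_0,\dots,v_{n-1})$ be the cycle. In the Random Majority Model (RMM) on $C_n$, the only winning set is the set of all nodes. In the Majority Model (MM) on $C_n$, the minimum size of a winning set equals $\lfloor n/2\rfloor+1$.
   Context: A coloring is a map from the nodes to $\{b,w\}$. In MM, all nodes update simultaneously: a node adopts the color strictly more frequent among its neighbors in the previous round and keeps its color in case of a tie. RMM is the same except that in case of a tie the node chooses blue or white independently and uniformly at random. A node set $S$ is a winning set if, whenever all nodes of $S$ are blue (resp. white) initially, the process eventually reaches the coloring in which all nodes are blue (resp. white), regardless of the initial colors of the nodes outside $S$ and of all random choices (in RMM). -}

module Defs where

open import Data.Nat using (ℕ; zero; suc; _≤_; s≤s)
open import Data.Nat.Properties using (<-cmp; 1+n≢n) renaming (_≟_ to _≟ℕ_)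
open import Data.Fin using (Fin; toℕ)
open import Data.Fin.Subset using (Subset; _∈_; ∣_∣)
open import Data.List using (length; filter; allFin)
open import Data.Product using (_×_; _,_; ∃-syntax)
open import Data.Sum using (_⊎_; inj₁; inj₂; swap)
open import Relation.Nullary using (¬_; yes; no; _×-dec_; _⊎-dec_)
open import Relation.Binary using (Decidable; DecidableEquality; tri<; tri≈; tri>)
open import Relation.Binary.PropositionalEquality using (_≡_; refl; sym; trans; cong)

record Graph (n : ℕ) : Set₁ where
  field
    Adj    : Fin n → Fin n → Set
    adj?   : Decidable Adj
    symm   : ∀ {u v} → Adj u v → Adj v u
    irrefl : ∀ {v} → ¬ Adj v v

-- Next n i j says that v_j directly follows v_i in the cyclic order
-- v_0, …, v_{n-1}, v_0.
Next : (n : ℕ) → Fin n → Fin n → Set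
Next n i j = toℕ j ≡ suc (toℕ i) ⊎ (suc (toℕ i) ≡ n × toℕ j ≡ 0)

next? : (n : ℕ) → Decidable (Next n)
next? n i j =
  (toℕ j ≟ℕ suc (toℕ i)) ⊎-dec ((suc (toℕ i) ≟ℕ n) ×-dec (toℕ j ≟ℕ 0))

¬Next-refl : ∀ {n} → 3 ≤ n → (i : Fin n) → ¬ Next n i i
¬Next-refl 3≤n i (inj₁ eq) = 1+n≢n (sym eq)
¬Next-refl (s≤s (s≤s _)) i (inj₂ (eq , z)) with trans (sym (cong suc z)) eq
... | ()

cycle : (n : ℕ) → 3 ≤ n → Graph n
cycle n 3≤n = record
  { Adj    = λ i j → Next n i j ⊎ Next n j i
  ; adj?   = λ i j → next? n i j ⊎-dec next? n j i
  ; symm   = swap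
  ; irrefl = λ { {v} (inj₁ p) → ¬Next-refl 3≤n v p
               ; {v} (inj₂ p) → ¬Next-refl 3≤n v p }
  }

data Color : Set where
  b w : Color

_≟_ : DecidableEquality Color
b ≟ b = yes refl
b ≟ w = no λ ()
w ≟ b = no λ ()
w ≟ w = yes refl

Coloring : ℕ → Set
Coloring n = Fin n → Color

module _ {n : ℕ} (G : Graph n) where
  open Graph G

  countNeighbors : Coloring n → Fin n → Color → ℕ
  countNeighbors χ v c =
    length (filter (λ u → adj? v u ×-dec (χ u ≟ c)) (allFin n))

  -- One synchronous round; `tie v` is the color v takes in case of a tie.
  step : (tie : Coloring n) → Coloring n → Coloring n
  step tie χ v with <-cmp (countNeighbors χ v b) (countNeighbors χ v w)
  ... | tri< _ _ _ = w
  ... | tri≈ _ _ _ = tie v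
  ... | tri> _ _ _ = b

  runMM : Coloring n → ℕ → Coloring n
  runMM χ₀ zero    = χ₀
  runMM χ₀ (suc t) = step (runMM χ₀ t) (runMM χ₀ t)

  -- `r t v` is the outcome of the coin of node v in round t + 1, which is
  -- consulted only in case of a tie.  The coins are independent and fair, so
  -- every r is a possible (infinite) sequence of random choices.
  runRMM : (r : ℕ → Coloring n) → Coloring n → ℕ → Coloring n
  runRMM r χ₀ zero    = χ₀
  runRMM r χ₀ (suc t) = step (r t) (runRMM r χ₀ t)

  WinningMM : Subset n → Set
  WinningMM S = ∀ (c : Color) (χ₀ : Coloring n) → (∀ v → v ∈ S → χ₀ v ≡ c) →
    ∃[ t ] (∀ v → runMM χ₀ t v ≡ c)

  WinningRMM : Subset n → Set
  WinningRMM S = ∀ (c : Color) (χ₀ : Coloring n) → (∀ v → v ∈ S → χ₀ v ≡ c) →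
    ∀ (r : ℕ → Coloring n) → ∃[ t ] (∀ v → runRMM r χ₀ t v ≡ c)

IsMinimumSize : ∀ {n} → (Subset n → Set) → ℕ → Set
IsMinimumSize P k = (∃[ S ] (P S × ∣ S ∣ ≡ k)) × (∀ S → P S → k ≤ ∣ S ∣)

{-# OPTIONS --safe #-}

-- On a cycle a node has a tie exactly when its two neighbours disagree.
--
-- RMM: if every tie is resolved to white, the successor of a white node is
-- white one round later, so white never dies out.
--
-- MM, lower bound: colour S blue and the rest white.  Two consecutive white
-- nodes stay white, and a perfectly alternating coloring keeps alternating, so
-- if S wins then no two consecutive nodes are both outside S and some two are
-- both inside.  Summing over all consecutive pairs gives n < 2 ∣S∣.
--
-- MM, upper bound: take the nodes of even index together with v_{n-1}.  After t
-- rounds v_i has the right color if i ≤ t, or i ≡ t (mod 2), or i = n - 1: the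
-- block around the adjacent pair v_{n-1}, v_0 is stable and absorbs the
-- (possibly blinking) nodes one after the other.
module Submission where

open import Data.Empty using (⊥)
open import Data.Fin using (Fin; zero; suc; toℕ; fromℕ; inject₁; punchIn)
open import Data.Fin.Permutation using (permutation)
open import Data.Fin.Properties using (toℕ-fromℕ; toℕ-inject₁; toℕ-injective; toℕ<n; any?)
open import Data.Fin.Relation.Unary.Top using (view; ‵fromℕ; ‵inject₁)
open import Data.Fin.Subset using (Subset; ⊤; _∈_; _∉_; ∣_∣; Side; inside; outside)
open import Data.Fin.Subset.Properties using (_∈?_; ∈⊤; ⊆⊤; ⊆-antisym)
open import Data.List using (List; []; _∷_; length; map; filter; allFin)
open import Data.List.Membership.Propositional using () renaming (_∈_ to _∈ˡ_)
open import Data.List.Membership.Propositional.Properties using (∈-filter⁺; ∈-filter⁻; ∈-allFin)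
open import Data.List.Membership.Propositional.Properties.WithK using (unique∧set⇒bag)
open import Data.List.Relation.Binary.BagAndSetEquality using (∼bag⇒↭)
open import Data.List.Relation.Binary.Permutation.Propositional.Properties using (↭-length)
open import Data.List.Relation.Unary.All using ([]; _∷_)
open import Data.List.Relation.Unary.AllPairs using ([]; _∷_)
open import Data.List.Relation.Unary.Any using (here; there)
open import Data.List.Relation.Unary.Unique.Propositional using (Unique)
open import Data.List.Relation.Unary.Unique.Propositional.Properties using (filter⁺; allFin⁺)
open import Data.Nat using (ℕ; zero; suc; _≤_; _<_; _+_; ⌊_/2⌋; z≤n; s≤s)
open import Data.Nat.Divisibility using (_∣_; ∣m+n∣m⇒∣n; ∣-refl; m∣m*n; >⇒∤)
open import Data.Nat.Properties using (<-cmp; ≤-refl; ≤-trans; ≤-reflexive; <⇒≤; <-irrefl; +-mono-≤; +-suc; +-comm; +-identityʳ; suc-injective; ≰⇒>; <-≤-trans; n≤1+n; m≤n⇒m<n∨m≡n; ⌊n/2⌋≤⌈n/2⌉; ⌊n/2⌋+⌈n/2⌉≡n; +-0-commutativeMonoid) renaming (_≤?_ to _≤ℕ?_)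
open import Data.Product using (_×_; _,_; proj₁; ∃-syntax)
open import Data.Sum using (inj₁; inj₂)
open import Data.Vec using ([]; _∷_; here; there; lookup)
open import Data.Vec.Properties using (lookup⇒[]=; []=⇒lookup)
open import Function using (_∘_)
open import Function.Bundles using (_⇔_; mk⇔)
open import Relation.Binary using (tri<; tri≈; tri>)
open import Relation.Nullary using (¬_; yes; no; _×-dec_; contradiction)
open import Relation.Binary.PropositionalEquality using (_≡_; _≢_; refl; sym; trans; cong; cong₂; subst)
open import Defs

open import Algebra.Properties.CommutativeMonoid.Sum +-0-commutativeMonoid using (sum; sum-remove; sum-permute; ∑-distrib-+)

-- The cyclic order on nodes.

next-functional : ∀ {n} {i j k : Fin n} → Next n i j → Next n i k → j ≡ k
next-functional (inj₁ p) (inj₁ q) = toℕ-injective (trans p (sym q))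
next-functional {j = j} (inj₁ p) (inj₂ (q , _)) = contradiction (toℕ<n j) (<-irrefl (trans p q))
next-functional {k = k} (inj₂ (p , _)) (inj₁ q) = contradiction (toℕ<n k) (<-irrefl (trans q p))
next-functional (inj₂ (_ , p)) (inj₂ (_ , q)) = toℕ-injective (trans p (sym q))

next-injective : ∀ {n} {i j k : Fin n} → Next n j i → Next n k i → j ≡ k
next-injective (inj₁ p) (inj₁ q) = toℕ-injective (suc-injective (trans (sym p) q))
next-injective (inj₁ p) (inj₂ (_ , q)) with () ← trans (sym q) p
next-injective (inj₂ (_ , p)) (inj₁ q) with () ← trans (sym p) q
next-injective (inj₂ (p , _)) (inj₂ (q , _)) = toℕ-injective (suc-injective (trans p (sym q)))

-- Fails for two nodes, where each follows the other. This is what makes the two neighbors of a node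
-- distinct, so that a tie is a disagreement between two different nodes.
next-asym : ∀ {n} → 3 ≤ n → {i j : Fin n} → Next n i j → Next n j i → ⊥
next-asym _ {i} (inj₁ p) (inj₁ q) = <-irrefl (trans q (cong suc p)) (s≤s (n≤1+n (toℕ i)))
next-asym (s≤s (s≤s (s≤s _))) (inj₁ p) (inj₂ (q , r)) with () ← trans (sym q) (cong suc (trans p (cong suc r)))
next-asym (s≤s (s≤s (s≤s _))) (inj₂ (p , q)) (inj₁ r) with () ← trans (sym p) (cong suc (trans r (cong suc q)))
next-asym (s≤s (s≤s (s≤s _))) (inj₂ (p , q)) (inj₂ (r , s)) with () ← trans (sym p) (cong suc s)

succ : ∀ {m} → Fin (suc m) → Fin (suc m)
succ i with view i
... | ‵fromℕ     = zero
... | ‵inject₁ j = suc j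

pred : ∀ {m} → Fin (suc m) → Fin (suc m)
pred zero    = fromℕ _
pred (suc i) = inject₁ i

next-succ : ∀ {m} (i : Fin (suc m)) → Next (suc m) i (succ i)
next-succ i with view i
... | ‵fromℕ     = inj₂ (cong suc (toℕ-fromℕ _) , refl)
... | ‵inject₁ j = inj₁ (cong suc (sym (toℕ-inject₁ j)))

next-pred : ∀ {m} (i : Fin (suc m)) → Next (suc m) (pred i) i
next-pred zero    = inj₂ (cong suc (toℕ-fromℕ _) , refl)
next-pred (suc i) = inj₁ (cong suc (sym (toℕ-inject₁ i)))

succ-pred : ∀ {m} (i : Fin (suc m)) → succ (pred i) ≡ i
succ-pred i = next-functional (next-succ (pred i)) (next-pred i)

pred-succ : ∀ {m} (i : Fin (suc m)) → pred (succ i) ≡ i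
pred-succ i = next-injective (next-pred (succ i)) (next-succ i)

-- Majority among two neighbors.

unique∧set⇒length : ∀ {A : Set} {xs ys : List A} → Unique xs → Unique ys →
  (∀ {x} → x ∈ˡ xs ⇔ x ∈ˡ ys) → length xs ≡ length ys
unique∧set⇒length xs! ys! eq = ↭-length (∼bag⇒↭ (unique∧set⇒bag xs! ys! eq))

length-filter-map : ∀ {A : Set} (χ : A → Color) c xs →
  length (filter (λ x → χ x ≟ c) xs) ≡ length (filter (_≟ c) (map χ xs))
length-filter-map χ c [] = refl
length-filter-map χ c (x ∷ xs) with χ x ≟ c
... | yes _ = cong suc (length-filter-map χ c xs)
... | no _  = length-filter-map χ c xs

-- The case split inside `step` as a function of the two counts alone, so that the counts can be
-- replaced by equal ones.
majority : (blues whites : ℕ) (tie : Color) → Color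
majority x y t with <-cmp x y
... | tri< _ _ _ = w
... | tri≈ _ _ _ = t
... | tri> _ _ _ = b

step-majority : ∀ {n} (G : Graph n) tie χ v →
  step G tie χ v ≡ majority (countNeighbors G χ v b) (countNeighbors G χ v w) (tie v)
step-majority G tie χ v with <-cmp (countNeighbors G χ v b) (countNeighbors G χ v w)
... | tri< _ _ _ = refl
... | tri≈ _ _ _ = refl
... | tri> _ _ _ = refl

resolve : (left right tie : Color) → Color
resolve b b _ = b
resolve w w _ = w
resolve b w t = t
resolve w b t = t

majority-pair : ∀ c d t →
  majority (length (filter (_≟ b) (c ∷ d ∷ []))) (length (filter (_≟ w) (c ∷ d ∷ []))) t ≡ resolve c d t
majority-pair b b t = refl
majority-pair b w t = refl
majority-pair w b t = refl
majority-pair w w t = refl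

resolve-agree : ∀ c t → resolve c c t ≡ c
resolve-agree b t = refl
resolve-agree w t = refl

-- Either the other neighbor agrees on `c`, or there is a tie and the tie color is `c` again.
resolve-left : ∀ c d → resolve c d c ≡ c
resolve-left b b = refl
resolve-left b w = refl
resolve-left w b = refl
resolve-left w w = refl

resolve-right : ∀ c d → resolve d c c ≡ c
resolve-right b b = refl
resolve-right b w = refl
resolve-right w b = refl
resolve-right w w = refl

≢-≢⇒≡ : ∀ {c d e : Color} → c ≢ d → d ≢ e → c ≡ e
≢-≢⇒≡ {b} {b} p q = contradiction refl p
≢-≢⇒≡ {b} {w} {b} p q = refl
≢-≢⇒≡ {b} {w} {w} p q = contradiction refl q
≢-≢⇒≡ {w} {b} {b} p q = contradiction refl q
≢-≢⇒≡ {w} {b} {w} p q = refl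
≢-≢⇒≡ {w} {w} p q = contradiction refl p

-- Indicator colorings and counting.

weight : Color → ℕ
weight b = 1
weight w = 0

color : Side → Color
color inside  = b
color outside = w

indicator : ∀ {n} → Subset n → Coloring n
indicator S v = color (lookup S v)

indicator-∈ : ∀ {n} (S : Subset n) v → v ∈ S → indicator S v ≡ b
indicator-∈ S v v∈S = cong color ([]=⇒lookup v∈S)

indicator-∉ : ∀ {n} (S : Subset n) v → v ∉ S → indicator S v ≡ w
indicator-∉ S v v∉S with lookup S v in eq
... | inside  = contradiction (lookup⇒[]= v S eq) v∉S
... | outside = refl

sum-indicator : ∀ {n} (S : Subset n) → sum (weight ∘ indicator S) ≡ ∣ S ∣
sum-indicator []            = refl
sum-indicator (inside ∷ S)  = cong suc (sum-indicator S)
sum-indicator (outside ∷ S) = sum-indicator S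

n≤sum : ∀ {n} (f : Fin n → ℕ) → (∀ i → 1 ≤ f i) → n ≤ sum f
n≤sum {zero}  f 1≤f = z≤n
n≤sum {suc n} f 1≤f = +-mono-≤ (1≤f zero) (n≤sum (f ∘ suc) (1≤f ∘ suc))

n<sum : ∀ {n} (f : Fin n → ℕ) → (∀ i → 1 ≤ f i) → ∀ i → 2 ≤ f i → n < sum f
n<sum {suc n} f 1≤f i 2≤fi = ≤-trans
  (+-mono-≤ 2≤fi (n≤sum (f ∘ punchIn i) (1≤f ∘ punchIn i)))
  (≤-reflexive (sym (sum-remove f)))

-- Otherwise `k` is at most both halves ⌊n/2⌋ and ⌈n/2⌉, whose sum is `n`.
n<k+k⇒⌊n/2⌋+1≤k : ∀ n k → n < k + k → ⌊ n /2⌋ + 1 ≤ k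
n<k+k⇒⌊n/2⌋+1≤k n k n<2k with ⌊ n /2⌋ + 1 ≤ℕ? k
... | yes p = p
... | no ¬p = contradiction (<-≤-trans n<2k 2k≤n) (<-irrefl refl)
  where
  k≤⌊n/2⌋ : k ≤ ⌊ n /2⌋
  k≤⌊n/2⌋ with s≤s q ← subst (k <_) (+-comm ⌊ n /2⌋ 1) (≰⇒> ¬p) = q
  2k≤n : k + k ≤ n
  2k≤n = ≤-trans (+-mono-≤ k≤⌊n/2⌋ (≤-trans k≤⌊n/2⌋ (⌊n/2⌋≤⌈n/2⌉ n))) (≤-reflexive (⌊n/2⌋+⌈n/2⌉≡n n))

-- The extremal set for MM.

evensAndLast : ∀ n → Subset n
evensAndLast 0             = []
evensAndLast 1             = inside ∷ []
evensAndLast 2             = inside ∷ inside ∷ []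
evensAndLast (suc (suc n@(suc _))) = inside ∷ outside ∷ evensAndLast n

∣evensAndLast∣ : ∀ m → ∣ evensAndLast (suc m) ∣ ≡ ⌊ suc m /2⌋ + 1
∣evensAndLast∣ 0             = refl
∣evensAndLast∣ 1             = refl
∣evensAndLast∣ (suc (suc m)) = cong suc (∣evensAndLast∣ m)

-- The nodes that are guaranteed to have the winning color after t rounds when
-- `evensAndLast n` starts in it.
data Conquered (n t i : ℕ) : Set where
  block  : i ≤ t → Conquered n t i
  parity : 2 ∣ i + t → Conquered n t i
  last   : suc i ≡ n → Conquered n t i

-- At time 0 the conquered nodes are those of even index and the last one. Dropping the first two
-- nodes preserves both properties, matching the recursion of `evensAndLast`.
conquered⇒∈ : ∀ {n} (v : Fin n) → Conquered n 0 (toℕ v) → v ∈ evensAndLast n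
conquered⇒∈ {1} zero _ = here
conquered⇒∈ {2} zero _ = here
conquered⇒∈ {2} (suc zero) _ = there here
conquered⇒∈ {suc (suc (suc _))} zero _ = here
conquered⇒∈ {suc (suc (suc _))} (suc zero) (parity 2∣1) = contradiction 2∣1 (>⇒∤ ≤-refl)
conquered⇒∈ {suc (suc (suc _))} (suc (suc v)) (parity 2∣i) = there (there (conquered⇒∈ v (parity (∣m+n∣m⇒∣n 2∣i ∣-refl))))
conquered⇒∈ {suc (suc (suc _))} (suc (suc v)) (last eq) = there (there (conquered⇒∈ v (last (suc-injective (suc-injective eq)))))

-- One round on the cycle.

module _ {m : ℕ} (3≤n : 3 ≤ suc m) where

  private
    n = suc m
    G = cycle n 3≤n

  succ≢pred : (v : Fin n) → succ v ≢ pred v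
  succ≢pred v eq = next-asym 3≤n (next-succ v) (subst (λ u → Next n u v) (sym eq) (next-pred v))

  neighbors : Fin n → List (Fin n)
  neighbors v = succ v ∷ pred v ∷ []

  -- Both filtered lists are duplicate-free with the same members, hence permutations of each other.
  -- The explicit two-element list then lets the majority be computed by cases on two colors.
  countNeighbors-cycle : ∀ χ v c →
    countNeighbors G χ v c ≡ length (filter (λ u → χ u ≟ c) (neighbors v))
  countNeighbors-cycle χ v c = unique∧set⇒length
    (filter⁺ P? (allFin⁺ n))
    (filter⁺ Q? ((succ≢pred v ∷ []) ∷ [] ∷ []))
    (mk⇔ to from)
    where
    Q? = λ u → χ u ≟ c
    P? = λ u → Graph.adj? G v u ×-dec Q? u
    to : ∀ {u} → u ∈ˡ filter P? (allFin n) → u ∈ˡ filter Q? (neighbors v)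
    to u∈ with ∈-filter⁻ P? {xs = allFin n} u∈
    ... | _ , inj₁ v→u , χu≡c = ∈-filter⁺ Q? (here (next-functional v→u (next-succ v))) χu≡c
    ... | _ , inj₂ u→v , χu≡c = ∈-filter⁺ Q? (there (here (next-injective u→v (next-pred v)))) χu≡c
    from : ∀ {u} → u ∈ˡ filter Q? (neighbors v) → u ∈ˡ filter P? (allFin n)
    from u∈ with ∈-filter⁻ Q? {xs = neighbors v} u∈
    ... | here refl , χu≡c         = ∈-filter⁺ P? (∈-allFin _) (inj₁ (next-succ v) , χu≡c)
    ... | there (here refl) , χu≡c = ∈-filter⁺ P? (∈-allFin _) (inj₂ (next-pred v) , χu≡c)

  step-cycle : ∀ tie χ v → step G tie χ v ≡ resolve (χ (succ v)) (χ (pred v)) (tie v)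
  step-cycle tie χ v = trans (step-majority G tie χ v)
    (trans (cong₂ (λ x y → majority x y (tie v)) (count b) (count w))
           (majority-pair (χ (succ v)) (χ (pred v)) (tie v)))
    where
    count : ∀ c → countNeighbors G χ v c ≡ length (filter (_≟ c) (map χ (neighbors v)))
    count c = trans (countNeighbors-cycle χ v c) (length-filter-map χ c (neighbors v))

  step-agree : ∀ tie χ v {c} → χ (succ v) ≡ c → χ (pred v) ≡ c → step G tie χ v ≡ c
  step-agree tie χ v refl eq = trans (step-cycle tie χ v)
    (trans (cong (λ d → resolve (χ (succ v)) d (tie v)) eq) (resolve-agree _ _))

  -- Covers both models: in MM `tie` is the current coloring, so the hypothesis on `tie v` says that
  -- `v` already has color `c`; in RMM it is a condition on the coin.
  step-succ : ∀ tie χ v {c} → tie v ≡ c → χ (succ v) ≡ c → step G tie χ v ≡ c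
  step-succ tie χ v refl eq = trans (step-cycle tie χ v)
    (trans (cong (λ d → resolve d (χ (pred v)) (tie v)) eq) (resolve-left _ _))

  step-pred : ∀ tie χ v {c} → tie v ≡ c → χ (pred v) ≡ c → step G tie χ v ≡ c
  step-pred tie χ v refl eq = trans (step-cycle tie χ v)
    (trans (cong (λ d → resolve (χ (succ v)) d (tie v)) eq) (resolve-right _ _))

  -- Winning sets in RMM.

  white-survives : ∀ χ₀ v → χ₀ v ≡ w → ∀ t → ∃[ u ] runRMM G (λ _ _ → w) χ₀ t u ≡ w
  white-survives χ₀ v eq zero = v , eq
  white-survives χ₀ v eq (suc t) with white-survives χ₀ v eq t
  ... | u , χu≡w = succ u ,
    step-pred _ χ (succ u) refl (trans (cong χ (pred-succ u)) χu≡w)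
    where χ = runRMM G (λ _ _ → w) χ₀ t

  winningRMM⇒⊤ : ∀ S → WinningRMM G S → S ≡ ⊤
  winningRMM⇒⊤ S win = ⊆-antisym ⊆⊤ (λ {v} _ → all∈ v)
    where
    all∈ : ∀ v → v ∈ S
    all∈ v with v ∈? S
    ... | yes v∈S = v∈S
    -- With `S` blue and everything else white, `v` starts white; coins that always show white then
    -- rule out an all-blue coloring at any time.
    ... | no  v∉S
      with t , all-b ← win b (indicator S) (indicator-∈ S) (λ _ _ → w)
      with u , χu≡w ← white-survives (indicator S) v (indicator-∉ S v v∉S) t
      with () ← trans (sym (all-b u)) χu≡w

  ⊤-winningRMM : ∀ S → S ≡ ⊤ → WinningRMM G S
  ⊤-winningRMM S refl c χ₀ χ₀≡c r = 0 , λ v → χ₀≡c v ∈⊤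

  -- Lower bound in MM.

  white-pair-survives : ∀ χ₀ v → χ₀ v ≡ w → χ₀ (succ v) ≡ w →
    ∀ t → runMM G χ₀ t v ≡ w × runMM G χ₀ t (succ v) ≡ w
  white-pair-survives χ₀ v p q zero = p , q
  white-pair-survives χ₀ v p q (suc t) with white-pair-survives χ₀ v p q t
  ... | p′ , q′ = step-succ χ χ v p′ q′ ,
                  step-pred χ χ (succ v) q′ (trans (cong χ (pred-succ v)) p′)
    where χ = runMM G χ₀ t

  Alternating : Coloring n → Set
  Alternating χ = ∀ v → χ v ≢ χ (succ v)

  -- Both neighbors of `v` differ from `v`, so with only two colors they agree. A round therefore
  -- rotates the coloring by one position.
  step-alternating : ∀ χ → Alternating χ → ∀ v → step G χ χ v ≡ χ (succ v)
  step-alternating χ alt v = step-agree χ χ v refl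
    (≢-≢⇒≡ (λ eq → alt (pred v) (trans eq (cong χ (sym (succ-pred v))))) (alt v))

  alternating-survives : ∀ χ₀ → Alternating χ₀ → ∀ t → Alternating (runMM G χ₀ t)
  alternating-survives χ₀ alt zero = alt
  -- By the rotation, a clash at `v` after the round is a clash at `succ v` before it.
  alternating-survives χ₀ alt (suc t) v eq = alt′ (succ v)
    (trans (sym (step-alternating χ alt′ v)) (trans eq (step-alternating χ alt′ (succ v))))
    where
    χ = runMM G χ₀ t
    alt′ = alternating-survives χ₀ alt t

  sum-succ : ∀ (f : Fin n → ℕ) → sum (f ∘ succ) ≡ sum f
  sum-succ f = sym (sum-permute f (permutation succ pred succ-pred pred-succ))

  -- Double counting: each node lies in two consecutive pairs, so the pair weights sum to twice the
  -- size of `S`. Each of the `n` pairs contributes at least 1, and the monochromatic pair at `v`,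
  -- being blue, contributes 2.
  blue-pair⇒n<2∣S∣ : ∀ S → let χ = indicator S in
    (∀ v → ¬ (χ v ≡ w × χ (succ v) ≡ w)) →
    ∀ v → χ v ≡ χ (succ v) → n < ∣ S ∣ + ∣ S ∣
  blue-pair⇒n<2∣S∣ S no-ww v eq = subst (n <_) total
    (n<sum pairWeight 1≤pairWeight v (2≤pairWeight (no-ww v) eq))
    where
    χ = indicator S
    f = weight ∘ χ
    pairWeight : Fin n → ℕ
    pairWeight u = f u + f (succ u)
    1≤pairWeight : ∀ u → 1 ≤ pairWeight u
    1≤pairWeight u with χ u | χ (succ u) | no-ww u
    ... | b | _ | _ = s≤s z≤n
    ... | w | b | _ = s≤s z≤n
    ... | w | w | ¬ww = contradiction (refl , refl) ¬ww
    2≤pairWeight : ∀ {c d} → ¬ (c ≡ w × d ≡ w) → c ≡ d → 2 ≤ weight c + weight d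
    2≤pairWeight {b} _   refl = ≤-refl
    2≤pairWeight {w} ¬ww refl = contradiction (refl , refl) ¬ww
    total : sum pairWeight ≡ ∣ S ∣ + ∣ S ∣
    total = trans (∑-distrib-+ f (f ∘ succ))
      (cong₂ _+_ (sum-indicator S) (trans (sum-succ f) (sum-indicator S)))

  winningMM⇒size : ∀ S → WinningMM G S → ⌊ n /2⌋ + 1 ≤ ∣ S ∣
  winningMM⇒size S win
    with t , all-b ← win b (indicator S) (indicator-∈ S)
    with any? (λ v → (indicator S v ≟ w) ×-dec (indicator S (succ v) ≟ w))
  ... | yes (v , p , q)
    with () ← trans (sym (all-b v)) (proj₁ (white-pair-survives (indicator S) v p q t))
  ... | no no-ww with any? (λ v → indicator S v ≟ indicator S (succ v))
  ...   | yes (v , eq) = n<k+k⇒⌊n/2⌋+1≤k n ∣ S ∣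
    (blue-pair⇒n<2∣S∣ S (λ u ww → no-ww (u , ww)) v eq)
  -- No two consecutive nodes agree initially, so nodes 0 and 1 still differ at time `t`, when all
  -- should be blue.
  ...   | no alt = contradiction (trans (all-b zero) (sym (all-b (succ zero))))
    (alternating-survives (indicator S) (λ v eq → alt (v , eq)) t zero)

  -- Upper bound in MM: the invariant passes from `t` to `t + 1`.

  module _ (c : Color) (χ : Coloring n) (t : ℕ)
           (conquered : ∀ v → Conquered n t (toℕ v) → χ v ≡ c) where

    step-block : ∀ v → toℕ v ≤ t → step G χ χ v ≡ c
    step-block v v≤t with next-pred v
    ... | inj₁ v≡1+p   = step-pred χ χ v (conquered v (block v≤t))
      (conquered (pred v) (block (≤-trans (n≤1+n _) (≤-trans (≤-reflexive (sym v≡1+p)) v≤t))))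
    -- Here `v` is node 0, whose predecessor is the last node: these two support each other.
    ... | inj₂ (p-last , _) = step-pred χ χ v (conquered v (block v≤t)) (conquered (pred v) (last p-last))

    step-last : ∀ v → suc (toℕ v) ≡ n → step G χ χ v ≡ c
    step-last v v-last with next-succ v
    ... | inj₁ s≡1+v     = contradiction (toℕ<n (succ v)) (<-irrefl (trans s≡1+v v-last))
    ... | inj₂ (_ , s≡0) = step-succ χ χ v (conquered v (last v-last))
      -- Node 0 belongs to the block at every time, including `t = 0`.
      (conquered (succ v) (block (≤-trans (≤-reflexive s≡0) z≤n)))

    -- Away from the ends, both neighbors have index of the parity of `t`, so they agree on `c`
    -- whatever `v` itself is. At the ends the wrap-around may break parity, and the arguments for
    -- the last node and the block take over.
    step-parity : ∀ v → 2 ∣ toℕ v + suc t → step G χ χ v ≡ c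
    step-parity v 2∣v+1+t with next-succ v | next-pred v
    ... | inj₂ (v-last , _) | _ = step-last v v-last
    ... | inj₁ _ | inj₂ (_ , v≡0) = step-block v (≤-trans (≤-reflexive v≡0) z≤n)
    ... | inj₁ s≡1+v | inj₁ v≡1+p = step-agree χ χ v
      (conquered (succ v) (parity (subst (2 ∣_) (trans (+-suc _ t) (cong (_+ t) (sym s≡1+v))) 2∣v+1+t)))
      (conquered (pred v) (parity (∣m+n∣m⇒∣n
        (subst (2 ∣_) (trans (cong (_+ suc t) v≡1+p) (cong suc (+-suc _ t))) 2∣v+1+t) ∣-refl)))

    step-conquered : ∀ v → Conquered n (suc t) (toℕ v) → step G χ χ v ≡ c
    step-conquered v (parity p) = step-parity v p
    step-conquered v (last p)   = step-last v p
    step-conquered v (block v≤1+t) with m≤n⇒m<n∨m≡n v≤1+t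
    ... | inj₁ (s≤s v≤t) = step-block v v≤t
    -- The node joining the block has index `t + 1`, so index plus new time is `2 * (t + 1)`, which
    -- is even.
    ... | inj₂ v≡1+t = step-parity v (subst (2 ∣_)
      (trans (cong (suc t +_) (+-identityʳ _)) (cong (_+ suc t) (sym v≡1+t))) (m∣m*n (suc t)))

  evensAndLast-winning : WinningMM G (evensAndLast n)
  -- After `n` rounds the block `i ≤ t` contains every index.
  evensAndLast-winning c χ₀ χ₀≡c = n , λ v → invariant n v (block (<⇒≤ (toℕ<n v)))
    where
    invariant : ∀ t v → Conquered n t (toℕ v) → runMM G χ₀ t v ≡ c
    invariant zero    v p = χ₀≡c v (conquered⇒∈ v p)
    invariant (suc t) = step-conquered c (runMM G χ₀ t) t (invariant t)

theorem3p2 : (n : ℕ) (3≤n : 3 ≤ n) →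
    ((S : Subset n) → WinningRMM (cycle n 3≤n) S ⇔ S ≡ ⊤)
    × IsMinimumSize (WinningMM (cycle n 3≤n)) (⌊ n /2⌋ + 1)
theorem3p2 (suc m) 3≤n =
  (λ S → mk⇔ (winningRMM⇒⊤ 3≤n S) (⊤-winningRMM 3≤n S)) ,
  (evensAndLast (suc m) , evensAndLast-winning 3≤n , ∣evensAndLast∣ m) ,
  winningMM⇒size 3≤n
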